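{- Let $c\in\mathbb{N}$ and $I=\mathbb{N}\times[c]$. Then every $\mathrm{Sym}$-invariant lattice $L\subseteq\mathbb{Z}^{(I)}$ has a finite equivariant Graver basis, i.e. there is a finite set $\mathcal{G}\subseteq L$ such that $\mathrm{Sym}(\mathcal{G})=\{\sigma(\mathbf{u})\mid\sigma\in\mathrm{Sym},\mathbf{u}\in\mathcal{G}\}$ is the Graver basis of $L$.
   Context: $\mathbb{N}=\{1,2,\dots\}$, $[c]=\{1,\dots,c\}$. For a set $J$, $\mathbb{Z}^{(J)}$ is the free abelian group with basis $J$, i.e. finitely supported integer vectors $\mathbf{u}=(u_j)_{j\in J}$; a lattice is any subgroup of $\mathbb{Z}^{(J)}$. Define the partial order $\mathbf{u}\sqsubseteq\mathbf{v}$ iff $u_jv_j\ge0$ and $|u_j|\le|v_j|$ for all $j\in J$. The Graver basis of a lattice $L$ is the set of all $\sqsubseteq$-minimal elements of $L\setminus\{\mathbf{0}\}$. $\mathrm{Sym}$ denotes the group of permutations of $\mathbb{N}$ fixing all but finitely many elements. It acts on $\mathbb{Z}^{(\mathbb{N}\times[c])}$ by the linear extension of $\sigma(\mathbf{e}_{i,j})=\mathbf{e}_{\sigma(i),j}$, where $\mathbf{e}_{i,j}$ are the standard basis vectors. A lattice $L$ is $\mathrm{Sym}$-invariant if $\sigma(L)\subseteq L$ for all $\sigma\in\mathrm{Sym}$. -}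

module Defs where

open import Level using (Level; suc; _⊔_)
open import Data.Nat.Base using (ℕ) renaming (_≤_ to _≤ℕ_)
open import Data.Nat.Properties using () renaming (_≟_ to _≟ℕ_)
open import Data.Fin.Base using (Fin)
open import Data.Fin.Properties using () renaming (_≟_ to _≟F_)
open import Data.Integer.Base using (ℤ; 0ℤ; 1ℤ; _+_; _*_; -_; _≤_; ∣_∣)
open import Data.List.Base using (List; []; _∷_; _++_; map)
open import Data.List.Membership.Propositional using () renaming (_∈_ to _∈ₗ_; _∉_ to _∉ₗ_)
open import Data.List.Membership.Propositional.Properties using (∈-++⁺ˡ; ∈-++⁺ʳ; ∈-map⁺)
open import Data.List.Relation.Unary.Any using (here)
open import Data.Product.Base using (_×_; _,_; ∃-syntax; map₁)
open import Data.Product.Properties using (≡-dec)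
open import Function.Base using (_∘_)
open import Function.Bundles using (_↔_; Inverse)
open import Relation.Binary.Definitions using (DecidableEquality)
open import Relation.Binary.PropositionalEquality using (_≡_; refl; sym; cong; cong₂; subst)
open import Relation.Nullary using (¬_; yes; no; contradiction)
open import Relation.Unary using (Pred; _∈_)

private
  variable
    ℓ : Level
    J : Set

-- ℤ^(J).  `supp` only has to contain the support; it is not part of the
-- identity of the vector, which is why vectors are compared with _≈_.
record ℤ^⟨_⟩ (J : Set) : Set where
  field
    coeff   : J → ℤ
    supp    : List J
    outside : ∀ j → j ∉ₗ supp → coeff j ≡ 0ℤ

open ℤ^⟨_⟩ public

infix  4 _≈_ _⊑_
infixl 6 _⊕_
infixr 7 _•_

_≈_ : ℤ^⟨ J ⟩ → ℤ^⟨ J ⟩ → Set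
u ≈ v = ∀ j → coeff u j ≡ coeff v j

𝟎 : ℤ^⟨ J ⟩
𝟎 = record { coeff = λ _ → 0ℤ ; supp = [] ; outside = λ _ _ → refl }

_⊕_ : ℤ^⟨ J ⟩ → ℤ^⟨ J ⟩ → ℤ^⟨ J ⟩
u ⊕ v = record
  { coeff   = λ j → coeff u j + coeff v j
  ; supp    = supp u ++ supp v
  ; outside = λ j j∉ → cong₂ _+_ (outside u j (j∉ ∘ ∈-++⁺ˡ))
                                 (outside v j (j∉ ∘ ∈-++⁺ʳ (supp u)))
  }

⊖_ : ℤ^⟨ J ⟩ → ℤ^⟨ J ⟩
⊖ u = record
  { coeff   = λ j → - coeff u j
  ; supp    = supp u
  ; outside = λ j j∉ → cong -_ (outside u j j∉)
  }

record Lattice (J : Set) (ℓ : Level) : Set (suc ℓ) where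
  field
    Carrier  : Pred ℤ^⟨ J ⟩ ℓ
    resp-≈   : ∀ {u v} → u ≈ v → u ∈ Carrier → v ∈ Carrier
    𝟎-mem    : 𝟎 ∈ Carrier
    ⊕-closed : ∀ {u v} → u ∈ Carrier → v ∈ Carrier → u ⊕ v ∈ Carrier
    ⊖-closed : ∀ {u} → u ∈ Carrier → ⊖ u ∈ Carrier

open Lattice public using (Carrier)

_⊑_ : ℤ^⟨ J ⟩ → ℤ^⟨ J ⟩ → Set
u ⊑ v = ∀ j → (0ℤ ≤ coeff u j * coeff v j) × (∣ coeff u j ∣ ≤ℕ ∣ coeff v j ∣)

_∖𝟎 : Lattice J ℓ → Pred ℤ^⟨ J ⟩ ℓ
(L ∖𝟎) u = u ∈ Carrier L × ¬ (u ≈ 𝟎)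

Minimal : Pred ℤ^⟨ J ⟩ ℓ → Pred ℤ^⟨ J ⟩ ℓ
Minimal S u = u ∈ S × (∀ v → v ∈ S → v ⊑ u → v ≈ u)

GraverBasis : Lattice J ℓ → Pred ℤ^⟨ J ⟩ ℓ
GraverBasis L = Minimal (L ∖𝟎)

-- The index set {1,2,…} is represented by ℕ (i ↦ i ∸ 1), and [c] by Fin c.
Index : ℕ → Set
Index c = ℕ × Fin c

record Sym : Set where
  field
    perm  : ℕ ↔ ℕ
    moved : List ℕ
    fixes : ∀ i → i ∉ₗ moved → Inverse.to perm i ≡ i

  open Inverse perm public using (to; from; strictlyInverseˡ; strictlyInverseʳ)

-- The linear extension of σ(e_{i,j}) = e_{σ(i),j}: the (i,j) coordinate of
-- σ(u) is u_{σ⁻¹(i),j}.  See •-basis, •-⊕ and •-⊖.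
_•_ : ∀ {c} → Sym → ℤ^⟨ Index c ⟩ → ℤ^⟨ Index c ⟩
σ • u = record
  { coeff   = coeff u ∘ map₁ from
  ; supp    = map (map₁ to) (supp u)
  ; outside = λ { (i , j) ij∉ → outside u (from i , j) λ p →
      ij∉ (subst (λ k → (k , j) ∈ₗ map (map₁ to) (supp u)) (strictlyInverseˡ i)
                 (∈-map⁺ (map₁ to) p)) }
  }
  where open Sym σ

SymInvariant : ∀ {c} → Lattice (Index c) ℓ → Set ℓ
SymInvariant L = ∀ σ {u} → u ∈ Carrier L → σ • u ∈ Carrier L

Sym⟨_⟩ : ∀ {c} → List ℤ^⟨ Index c ⟩ → Pred ℤ^⟨ Index c ⟩ _
Sym⟨ G ⟩ v = ∃[ σ ] ∃[ u ] (u ∈ₗ G × v ≈ σ • u)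

_≟ᴵ_ : ∀ {c} → DecidableEquality (Index c)
_≟ᴵ_ = ≡-dec _≟ℕ_ _≟F_

𝐞 : ∀ {c} → Index c → ℤ^⟨ Index c ⟩
𝐞 {c} k = record { coeff = δ ; supp = k ∷ [] ; outside = out }
  where
  δ : Index c → ℤ
  δ l with l ≟ᴵ k
  ... | yes _ = 1ℤ
  ... | no  _ = 0ℤ

  out : ∀ l → l ∉ₗ (k ∷ []) → δ l ≡ 0ℤ
  out l l∉ with l ≟ᴵ k
  ... | yes l≡k = contradiction (here l≡k) l∉
  ... | no  _   = refl

•-basis : ∀ {c} (σ : Sym) i (j : Fin c) → σ • 𝐞 (i , j) ≈ 𝐞 (Sym.to σ i , j)
•-basis σ i j (k , l) with (Sym.from σ k , l) ≟ᴵ (i , j) | (k , l) ≟ᴵ (Sym.to σ i , j)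
... | yes _    | yes _    = refl
... | no  _    | no  _    = refl
... | yes refl | no  q    = contradiction (cong (_, l) (sym (Sym.strictlyInverseˡ σ k))) q
... | no  p    | yes refl = contradiction (cong (_, l) (Sym.strictlyInverseʳ σ i)) p

•-⊕ : ∀ {c} (σ : Sym) (u v : ℤ^⟨ Index c ⟩) → σ • (u ⊕ v) ≈ (σ • u) ⊕ (σ • v)
•-⊕ σ u v _ = refl

•-⊖ : ∀ {c} (σ : Sym) (u : ℤ^⟨ Index c ⟩) → σ • (⊖ u) ≈ ⊖ (σ • u)
•-⊖ σ u _ = refl

{-# OPTIONS --safe #-}

-- Read a vector as the word of its rows in ℤᶜ.  Rows are well-quasi-ordered by
-- the coordinatewise order (Dickson), hence so are words of rows under
-- embedding (Higman), and an embedding of the rows of u into those of v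
-- extends to a σ ∈ Sym with σ u ⊑ v.  For Graver basis elements this forces
-- σ u = v, so finitely many of them, above which all others lie, meet every orbit.
module Submission where

open import Defs
open import Axiom.ExcludedMiddle using (ExcludedMiddle)
open import Data.Nat.Base using (ℕ; NonZero)
open import Data.List.Base using (List)
open import Data.List.Relation.Unary.All using (All)
open import Data.Product.Base using (_×_; Σ-syntax)
open import Relation.Unary using (_≐_)

open import Level using (0ℓ)
open import Data.Empty using (⊥-elim)
open import Data.Fin.Base using (Fin; zero; suc)
open import Data.Fin.Properties using (all?)
open import Data.Integer.Base as ℤ using (ℤ; 0ℤ; +_; -[1+_]; ∣_∣)
import Data.Integer.Properties as ℤ
open import Data.List.Base using ([]; _∷_; _++_; applyUpTo; map)
open import Data.List.Extrema.Nat using (max; xs≤max)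
open import Data.List.Membership.Propositional using (find)
open import Data.List.Membership.Propositional.Properties using (∈-++⁺ˡ; ∈-++⁺ʳ; ∈-map⁺)
open import Data.List.Relation.Binary.Sublist.Heterogeneous using (Sublist; []; _∷ʳ_; _∷_; minimum)
open import Data.List.Relation.Binary.Sublist.Heterogeneous.Properties using (++⁺; sublist?)
open import Data.List.Relation.Unary.All as All using ([]; _∷_)
open import Data.List.Relation.Unary.Any using (Any; here; there)
open import Data.Nat.Base using (zero; suc; _≤_; _<_; z≤n; s≤s)
import Data.Nat.Properties as ℕ
open import Data.Nat.Induction using (<-wellFounded)
open import Data.Product.Base using (_,_; proj₁; proj₂; ∃-syntax)
open import Data.Product.Relation.Binary.Pointwise.NonDependent using (Pointwise)
open import Data.Sum.Base as Sum using (inj₁; inj₂)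
open import Data.Unit.Base using (⊤; tt)
open import Function.Base using (_∘_; id)
open import Function.Bundles using (mk↔ₛ′)
open import Function.Construct.Composition using (_↔-∘_)
open import Function.Construct.Identity using (↔-id)
open import Function.Construct.Symmetry using (↔-sym)
open import Induction.WellFounded using (Acc; acc)
open import Relation.Binary.Core using (Rel)
open import Relation.Binary.Definitions using (Decidable)
open import Relation.Binary.PropositionalEquality using (_≡_; _≢_; refl; sym; trans; cong; subst)
open import Relation.Nullary using (Dec; ¬_; yes; no; contradiction)
open import Relation.Nullary.Decidable using (_×-dec_)
open import Relation.Unary using (Pred; _∪_; _⊆_; _⟨×⟩_; U)

private
  variable
    A B : Set

-- Well-quasi-orders and their closure properties

Residual : Rel A 0ℓ → Pred A 0ℓ → A → Pred A 0ℓ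
Residual _≤_ P x y = P y × ¬ (x ≤ y)

-- P is well-quasi-ordered by _≤_, as well-foundedness of the tree of bad
-- sequences in P; this form needs no choice of infinite sequences.
data WQO {A : Set} (_≤_ : Rel A 0ℓ) (P : Pred A 0ℓ) : Set₁ where
  wqo : (∀ x → P x → WQO _≤_ (Residual _≤_ P x)) → WQO _≤_ P

-- A bad sequence in `Q` is shadowed term by term by a bad sequence in `P`. Since `E` is a relation,
-- this covers subsets, images under monotone maps and orders pulled back along a function.
WQO-simulation : {_≤ᴬ_ : Rel A 0ℓ} {_≤ᴮ_ : Rel B 0ℓ} (E : B → A → Set) →
                 (∀ {b b′ a a′} → E b a → E b′ a′ → a ≤ᴬ a′ → b ≤ᴮ b′) →
                 ∀ {P Q} → (∀ b → Q b → ∃[ a ] (P a × E b a)) →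
                 WQO _≤ᴬ_ P → WQO _≤ᴮ_ Q
WQO-simulation E mono cover (wqo h) = wqo λ b qb →
  let a , pa , eba = cover b qb in
  WQO-simulation E mono
    (λ { b′ (qb′ , b≰b′) → let a′ , pa′ , eb′a′ = cover b′ qb′ in
         a′ , (pa′ , b≰b′ ∘ mono eba eb′a′) , eb′a′ })
    (h a pa)

WQO-⊆ : {_≤_ : Rel A 0ℓ} {P Q : Pred A 0ℓ} → Q ⊆ P → WQO _≤_ P → WQO _≤_ Q
WQO-⊆ Q⊆P = WQO-simulation _≡_ (λ { refl refl → id }) (λ b qb → b , Q⊆P qb , refl)

-- Each term of a bad sequence lies in `P` or in `Q`, and so descends in one of the two trees while
-- the other is kept.
WQO-∪ : {_≤_ : Rel A 0ℓ} {P Q : Pred A 0ℓ} → WQO _≤_ P → WQO _≤_ Q → WQO _≤_ (P ∪ Q)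
WQO-∪ p@(wqo f) q@(wqo g) = wqo λ where
  x (inj₁ px) → WQO-⊆ (λ { (y∈ , x≰y) → Sum.map₁ (_, x≰y) y∈ }) (WQO-∪ (f x px) q)
  x (inj₂ qx) → WQO-⊆ (λ { (y∈ , x≰y) → Sum.map₂ (_, x≰y) y∈ }) (WQO-∪ p (g x qx))

-- A pair not above `(x , y)` fails in one coordinate, and deciding `_≤ᴬ_` tells which. The residual
-- is thus covered by two products, each with one factor shrunk.
WQO-× : {_≤ᴬ_ : Rel A 0ℓ} {_≤ᴮ_ : Rel B 0ℓ} → Decidable _≤ᴬ_ →
        ∀ {P Q} → WQO _≤ᴬ_ P → WQO _≤ᴮ_ Q → WQO (Pointwise _≤ᴬ_ _≤ᴮ_) (P ⟨×⟩ Q)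
WQO-× {_≤ᴬ_ = _≤ᴬ_} {_≤ᴮ_} _≤?_ {P} {Q} p@(wqo f) q@(wqo g) = wqo λ where
    (x , y) (px , qy) → WQO-⊆ (split x y) (WQO-∪ (WQO-× _≤?_ (f x px) q) (WQO-× _≤?_ p (g y qy)))
  where
  split : ∀ x y → Residual (Pointwise _≤ᴬ_ _≤ᴮ_) (P ⟨×⟩ Q) (x , y) ⊆
          (Residual _≤ᴬ_ P x ⟨×⟩ Q) ∪ (P ⟨×⟩ Residual _≤ᴮ_ Q y)
  split x y {x′ , y′} ((px′ , qy′) , ≰) with x ≤? x′
  ... | yes x≤x′ = inj₂ (px′ , qy′ , λ y≤y′ → ≰ (x≤x′ , y≤y′))
  ... | no  x≰x′ = inj₁ ((px′ , x≰x′) , qy′)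

-- Higman's lemma

module _ {A : Set} {_≤ᴬ_ : Rel A 0ℓ} (_≤?_ : Decidable _≤ᴬ_) where

  private
    _⊴_ : Rel (List A) 0ℓ
    _⊴_ = Sublist _≤ᴬ_

  join : List A × A × List A → List A
  join (v₁ , b , v₂) = v₁ ++ b ∷ v₂

  Factored : Pred A 0ℓ → A → List A → Pred (List A) 0ℓ
  Factored P a w v = ∃[ t ]
    ((All (Residual _≤ᴬ_ P a) ⟨×⟩ (P ⟨×⟩ Residual _⊴_ (All P) w)) t × v ≡ join t)

  -- The factorisation is at the first letter above a.
  factor : ∀ {P} a w → Residual _⊴_ (All P) (a ∷ w) ⊆ All (Residual _≤ᴬ_ P a) ∪ Factored P a w
  factor a w {[]}    ([]      , _) = inj₁ []
  factor a w {b ∷ v} (pb ∷ pv , ⋬) with a ≤? b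
  ... | yes a≤b = inj₂ (([] , b , v) , ([] , pb , pv , λ w⊴v → ⋬ (a≤b ∷ w⊴v)) , refl)
  ... | no  a≰b with factor a w (pv , ⋬ ∘ (b ∷ʳ_))
  ...   | inj₁ pv′ = inj₁ ((pb , a≰b) ∷ pv′)
  ...   | inj₂ ((v₁ , b′ , v₂) , (pv₁ , rest) , refl) =
            inj₂ ((b ∷ v₁ , b′ , v₂) , ((pb , a≰b) ∷ pv₁ , rest) , refl)

  -- By `factor`, a word avoiding `a ∷ w` has no letter above `a`, or splits into such a word, one
  -- letter and a word avoiding `w`. The recursion is nested: `star` descends in the tree of
  -- letters, `avoiding` shortens the avoided word.
  higman : ∀ {P} → WQO _≤ᴬ_ P → WQO _⊴_ (All P)
  higman {P} p@(wqo h) = wqo avoiding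
    where
    avoiding : ∀ w → All P w → WQO _⊴_ (Residual _⊴_ (All P) w)
    avoiding []      []        = wqo λ { v (_ , ⋬) → contradiction (minimum v) ⋬ }
    avoiding (a ∷ w) (pa ∷ pw) = WQO-⊆ (factor a w) (WQO-∪ star factored)
      where
      star : WQO _⊴_ (All (Residual _≤ᴬ_ P a))
      star = higman (h a pa)

      factored : WQO _⊴_ (Factored P a w)
      factored = WQO-simulation (λ v t → v ≡ join t)
        (λ { refl refl (v₁⊴ , b≤ , v₂⊴) → ++⁺ v₁⊴ (b≤ ∷ v₂⊴) })
        (λ _ → id)
        (WQO-× (sublist? _≤?_) star (WQO-× _≤?_ p (avoiding w pw)))

-- Dickson's lemma for rows of integers

ℕ-wqo : WQO _≤_ U
ℕ-wqo = wqo λ n _ → WQO-⊆ (ℕ.≰⇒> ∘ proj₂) (below (<-wellFounded n))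
  where
  below : ∀ {n} → Acc _<_ n → WQO _≤_ (_< n)
  -- Every later term of a bad sequence is smaller than `x`, so the tree follows the accessibility
  -- of `_<_`.
  below (acc rs) = wqo λ x x<n → WQO-⊆ (ℕ.≰⇒> ∘ proj₂) (below (rs x<n))

infix 4 _⊑ℤ_ _⊑ℤ?_ _⊑ᴿ_ _⊑ᴿ?_ _≼_ _≼?_

_⊑ℤ_ : Rel ℤ 0ℓ
x ⊑ℤ y = (0ℤ ℤ.≤ x ℤ.* y) × (∣ x ∣ ≤ ∣ y ∣)

_⊑ℤ?_ : Decidable _⊑ℤ_
x ⊑ℤ? y = (0ℤ ℤ.≤? x ℤ.* y) ×-dec (∣ x ∣ ℕ.≤? ∣ y ∣)

0⊑ℤ : ∀ y → 0ℤ ⊑ℤ y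
0⊑ℤ y = ℤ.≤-refl , z≤n

-- Among integers of one sign only the absolute values matter, so each half is a copy of ℕ; zero is
-- counted with the nonnegative half.
ℤ-wqo : WQO _⊑ℤ_ U
ℤ-wqo = WQO-⊆ sign (WQO-∪ nonneg neg)
  where
  nonneg : WQO _⊑ℤ_ (λ z → ∃[ n ] (⊤ × z ≡ + n))
  nonneg = WQO-simulation (λ z n → z ≡ + n)
    (λ { {a = m} {n} refl refl m≤n → subst (0ℤ ℤ.≤_) (ℤ.pos-* m n) (ℤ.+≤+ z≤n) , m≤n })
    (λ _ → id) ℕ-wqo

  neg : WQO _⊑ℤ_ (λ z → ∃[ n ] (⊤ × z ≡ -[1+ n ]))
  neg = WQO-simulation (λ z n → z ≡ -[1+ n ])
    (λ { refl refl m≤n → ℤ.+≤+ z≤n , s≤s m≤n })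
    (λ _ → id) ℕ-wqo

  sign : U ⊆ (λ z → ∃[ n ] (⊤ × z ≡ + n)) ∪ (λ z → ∃[ n ] (⊤ × z ≡ -[1+ n ]))
  sign {+ n}      _ = inj₁ (n , tt , refl)
  sign { -[1+ n ]} _ = inj₂ (n , tt , refl)

Row : ℕ → Set
Row c = Fin c → ℤ

_⊑ᴿ_ : ∀ {c} → Rel (Row c) 0ℓ
r ⊑ᴿ s = ∀ j → r j ⊑ℤ s j

_⊑ᴿ?_ : ∀ {c} → Decidable (_⊑ᴿ_ {c})
r ⊑ᴿ? s = all? λ j → r j ⊑ℤ? s j

Row-wqo : ∀ c → WQO (_⊑ᴿ_ {c}) U
-- Any two empty rows are comparable, so nothing remains after the first.
Row-wqo zero    = wqo λ _ _ → wqo λ { _ (_ , ⋢) → ⊥-elim (⋢ λ ()) }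
Row-wqo (suc c) = WQO-simulation (λ (r : Row (suc c)) p → p ≡ (r zero , r ∘ suc))
  (λ { refl refl (r₀⊑ , rₛ⊑) → λ { zero → r₀⊑ ; (suc j) → rₛ⊑ j } })
  (λ r _ → _ , _ , refl)
  (WQO-× _⊑ℤ?_ ℤ-wqo (Row-wqo c))

-- Vectors as words of rows

row : ∀ {c} → ℤ^⟨ Index c ⟩ → ℕ → Row c
row u i j = coeff u (i , j)

-- The successor puts every listed row index strictly below the bound. With an empty `supp` the
-- default 0 still gives one row, which is zero.
bound : ∀ {c} → ℤ^⟨ Index c ⟩ → ℕ
bound u = suc (max 0 (map proj₁ (supp u)))

row-outside : ∀ {c} (u : ℤ^⟨ Index c ⟩) i → bound u ≤ i → ∀ j → row u i j ≡ 0ℤ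
row-outside u i b≤i j = outside u (i , j) λ ij∈ →
  ℕ.<⇒≱ b≤i (All.lookup (xs≤max 0 (map proj₁ (supp u))) (∈-map⁺ proj₁ ij∈))

rows : ∀ {c} → ℤ^⟨ Index c ⟩ → List (Row c)
rows u = applyUpTo (row u) (bound u)

-- This depends on the listed `supp` and does not respect `_≈_`; it serves only as a sufficient
-- condition for `σ • u ⊑ v`.
_≼_ : ∀ {c} → Rel ℤ^⟨ Index c ⟩ 0ℓ
u ≼ v = Sublist _⊑ᴿ_ (rows u) (rows v)

_≼?_ : ∀ {c} → Decidable (_≼_ {c})
u ≼? v = sublist? _⊑ᴿ?_ (rows u) (rows v)

≼-wqo : ∀ c → WQO (_≼_ {c}) U
≼-wqo c = WQO-simulation (λ u rs → rs ≡ rows u) (λ { refl refl → id })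
  (λ u _ → rows u , All.universal (λ _ → tt) _ , refl)
  (higman _⊑ᴿ?_ (Row-wqo c))

-- From embeddings of rows to finitary permutations

Injective : (ℕ → ℕ) → Set
Injective φ = ∀ {i k} → φ i ≡ φ k → i ≡ k

-- `φ` sends each position to that of its match. Past the embedded word it continues as a shift,
-- which keeps it injective on all of ℕ.
embedding⇒injection : ∀ {R : Rel A 0ℓ} n m (f g : ℕ → A) →
  Sublist R (applyUpTo f n) (applyUpTo g m) →
  ∃[ φ ] (Injective φ × ∀ i → i < n → R (f i) (g (φ i)))
embedding⇒injection zero    m       f g _ = id , id , λ _ ()
embedding⇒injection (suc n) (suc m) f g (_ ∷ʳ p) =
  let φ , φ-inj , f≤g = embedding⇒injection (suc n) m f (g ∘ suc) p
  in suc ∘ φ , φ-inj ∘ ℕ.suc-injective , f≤g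
embedding⇒injection {R = R} (suc n) (suc m) f g (r ∷ p) =
  let φ , φ-inj , f≤g = embedding⇒injection n m (f ∘ suc) (g ∘ suc) p
      ψ : ℕ → ℕ
      ψ = λ { zero → zero ; (suc i) → suc (φ i) }
      ψ-inj : Injective ψ
      ψ-inj = λ { {zero} {zero} _ → refl
                ; {suc i} {suc k} eq → cong suc (φ-inj (ℕ.suc-injective eq)) }
      f≤g′ : ∀ i → i < suc n → R (f i) (g (ψ i))
      f≤g′ = λ { zero _ → r ; (suc i) (s≤s i<n) → f≤g i i<n }
  in ψ , ψ-inj , f≤g′

idˢ : Sym
idˢ = record { perm = ↔-id ℕ ; moved = [] ; fixes = λ _ _ → refl }

_⁻¹ : Sym → Sym
σ ⁻¹ = record
  { perm  = ↔-sym perm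
  ; moved = moved
  ; fixes = λ i i∉ → trans (cong from (sym (fixes i i∉))) (strictlyInverseʳ i)
  }
  where open Sym σ

_∘ˢ_ : Sym → Sym → Sym
τ ∘ˢ σ = record
  { perm  = Sym.perm τ ↔-∘ Sym.perm σ
  ; moved = Sym.moved σ ++ Sym.moved τ
  ; fixes = λ i i∉ → trans (cong (Sym.to τ) (Sym.fixes σ i (i∉ ∘ ∈-++⁺ˡ)))
                           (Sym.fixes τ i (i∉ ∘ ∈-++⁺ʳ (Sym.moved σ)))
  }

swap : ℕ → ℕ → ℕ → ℕ
swap a b k with k ℕ.≟ a | k ℕ.≟ b
... | yes _ | _     = b
... | no _  | yes _ = a
... | no _  | no _  = k

swap-left : ∀ a b → swap a b a ≡ b
swap-left a b with a ℕ.≟ a | a ℕ.≟ b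
... | yes _  | _ = refl
... | no a≢a | _ = contradiction refl a≢a

swap-right : ∀ a b → swap a b b ≡ a
swap-right a b with b ℕ.≟ a | b ℕ.≟ b
... | yes b≡a | _      = b≡a
... | no _    | yes _  = refl
... | no _    | no b≢b = contradiction refl b≢b

swap-other : ∀ {a b k} → k ≢ a → k ≢ b → swap a b k ≡ k
swap-other {a} {b} {k} k≢a k≢b with k ℕ.≟ a | k ℕ.≟ b
... | yes k≡a | _       = contradiction k≡a k≢a
... | no _    | yes k≡b = contradiction k≡b k≢b
... | no _    | no _    = refl

swap-involutive : ∀ a b k → swap a b (swap a b k) ≡ k
swap-involutive a b k = by-cases (k ℕ.≟ a) (k ℕ.≟ b)
  where
  by-cases : Dec (k ≡ a) → Dec (k ≡ b) → swap a b (swap a b k) ≡ k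
  by-cases (yes refl) _          = trans (cong (swap a b) (swap-left a b)) (swap-right a b)
  by-cases (no _)     (yes refl) = trans (cong (swap a b) (swap-right a b)) (swap-left a b)
  by-cases (no k≢a)   (no k≢b)   = trans (cong (swap a b) k-fixed) k-fixed
    where k-fixed = swap-other k≢a k≢b

transpositionˢ : ℕ → ℕ → Sym
transpositionˢ a b = record
  { perm  = mk↔ₛ′ (swap a b) (swap a b) (swap-involutive a b) (swap-involutive a b)
  ; moved = a ∷ b ∷ []
  ; fixes = λ i i∉ → swap-other (i∉ ∘ here) (i∉ ∘ there ∘ here)
  }

-- A permutation right below `n` is corrected at `n` by transposing `to n` and `φ n`. Earlier values
-- equal neither, as `to` and `φ` are injective, so they survive.
injection⇒Sym : ∀ {φ} → Injective φ → ∀ n → ∃[ σ ] (∀ i → i < n → Sym.to σ i ≡ φ i)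
injection⇒Sym φ-inj zero = idˢ , λ _ ()
injection⇒Sym {φ} φ-inj (suc n) with injection⇒Sym φ-inj n
... | σ , σ≗φ = transpositionˢ (to n) (φ n) ∘ˢ σ , agree
  where
  open Sym σ
  to-injective : ∀ {i k} → to i ≡ to k → i ≡ k
  to-injective {i} {k} eq =
    trans (sym (strictlyInverseʳ i)) (trans (cong from eq) (strictlyInverseʳ k))

  agree : ∀ i → i < suc n → swap (to n) (φ n) (to i) ≡ φ i
  agree i (s≤s i≤n) with i ℕ.≟ n
  ... | yes refl = swap-left (to n) (φ n)
  ... | no i≢n   = trans (swap-other (i≢n ∘ to-injective) (i≢n ∘ φ-inj ∘ trans (sym to-i≡))) to-i≡
    where to-i≡ = σ≗φ i (ℕ.≤∧≢⇒< i≤n i≢n)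

≼⇒•⊑ : ∀ {c} {u v : ℤ^⟨ Index c ⟩} → u ≼ v → ∃[ σ ] (σ • u ⊑ v)
≼⇒•⊑ {c} {u} {v} u≼v with embedding⇒injection (bound u) (bound v) (row u) (row v) u≼v
... | φ , φ-inj , u≤v with injection⇒Sym φ-inj (bound u)
... | σ , σ≗φ = σ , σu⊑v
  where
  open Sym σ
  σu⊑v : σ • u ⊑ v
  σu⊑v (k , j) with from k ℕ.<? bound u
  ... | yes i<b = subst (λ l → row u (from k) j ⊑ℤ row v l j)
                        (trans (sym (σ≗φ (from k) i<b)) (strictlyInverseˡ k))
                        (u≤v (from k) i<b j)
  -- Row `k` of `σ • u` is zero here, and zero lies below everything.
  ... | no  i≮b = subst (_⊑ℤ row v k j) (sym (row-outside u (from k) (ℕ.≮⇒≥ i≮b) j))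
                        (0⊑ℤ (row v k j))

-- Finite bases and the Graver basis

finite-basis : ∀ {ℓ} → ExcludedMiddle ℓ → {_≤_ : Rel A 0ℓ} → Decidable _≤_ →
               (S : Pred A ℓ) → ∀ {P} → WQO _≤_ P →
               Σ[ F ∈ List A ] (All S F × ∀ v → S v → P v → Any (_≤ v) F)
-- Excluded middle finds an element of `S` in `P` or shows there is none; the recursion then
-- descends in the tree. `S` stays fixed and apart from the shrinking `P`, so it may live at level
-- `ℓ`.
finite-basis em {_≤_} _≤?_ S {P} (wqo h) with em {∃[ x ] (S x × P x)}
... | no  none = [] , [] , λ v sv pv → contradiction (v , sv , pv) none
... | yes (x , sx , px) with finite-basis em _≤?_ S (h x px)
...   | F , F⊆S , F-basis = x ∷ F , sx ∷ F⊆S , basis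
  where
  basis : ∀ v → S v → P v → Any (_≤ v) (x ∷ F)
  basis v sv pv with x ≤? v
  ... | yes x≤v = here x≤v
  ... | no  x≰v = there (F-basis v sv (pv , x≰v))

module _ {ℓ c} {L : Lattice (Index c) ℓ} (inv : SymInvariant L) where

  •-∖𝟎 : ∀ σ {u} → (L ∖𝟎) u → (L ∖𝟎) (σ • u)
  •-∖𝟎 σ {u} (u∈L , u≉𝟎) = inv σ u∈L , λ σu≈𝟎 → u≉𝟎 λ { (i , j) →
    subst (λ k → coeff u (k , j) ≡ 0ℤ) (Sym.strictlyInverseʳ σ i) (σu≈𝟎 (Sym.to σ i , j)) }

  -- An element `w` below `σ • u` is carried by `σ ⁻¹` to one below `u`; minimality of `u` gives
  -- equality, which `σ` carries back.
  •-GraverBasis : ∀ σ {u v} → v ≈ σ • u → GraverBasis L u → GraverBasis L v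
  •-GraverBasis σ {u} {v} v≈σu (u∈ , u-min) =
      (Lattice.resp-≈ L (sym ∘ v≈σu) (proj₁ σu∈) , λ v≈𝟎 → proj₂ σu∈ λ k → trans (sym (v≈σu k)) (v≈𝟎 k))
    , v-min
    where
    open Sym σ
    σu∈ = •-∖𝟎 σ u∈

    v-min : ∀ w → (L ∖𝟎) w → w ⊑ v → w ≈ v
    v-min w w∈ w⊑v (i , j) = trans
      (subst (λ k → coeff w (k , j) ≡ coeff u (from i , j)) (strictlyInverseˡ i)
             (σ⁻¹w≈u (from i , j)))
      (sym (v≈σu (i , j)))
      where
      σ⁻¹w≈u : (σ ⁻¹) • w ≈ u
      σ⁻¹w≈u = u-min _ (•-∖𝟎 (σ ⁻¹) w∈) λ { (k , l) →
        subst (coeff w (to k , l) ⊑ℤ_)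
              (trans (v≈σu (to k , l)) (cong (λ m → coeff u (m , l)) (strictlyInverseʳ k)))
              (w⊑v (to k , l)) }

theorem4p1 : ∀ {ℓ} → ExcludedMiddle ℓ →
    (c : ℕ) → .{{_ : NonZero c}} →
    (L : Lattice (Index c) ℓ) → SymInvariant L →
    Σ[ G ∈ List ℤ^⟨ Index c ⟩ ] (All (Carrier L) G × (Sym⟨ G ⟩ ≐ GraverBasis L))
theorem4p1 em c L inv with finite-basis em _≼?_ (GraverBasis L) (≼-wqo c)
... | G , G⊆Graver , G-basis = G , All.map (proj₁ ∘ proj₁) G⊆Graver , sound , complete
  where
  sound : Sym⟨ G ⟩ ⊆ GraverBasis L
  sound (σ , u , u∈G , v≈σu) = •-GraverBasis {L = L} inv σ v≈σu (All.lookup G⊆Graver u∈G)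

  complete : GraverBasis L ⊆ Sym⟨ G ⟩
  complete {v} v∈@(_ , v-min) with find (G-basis v v∈ tt)
  ... | u , u∈G , u≼v with ≼⇒•⊑ {u = u} {v} u≼v
  -- `σ • u` is a nonzero element of `L` below `v`, so minimality of `v` identifies the two.
  ... | σ , σu⊑v = σ , u , u∈G , sym ∘ v-min (σ • u) (•-∖𝟎 {L = L} inv σ u∈) σu⊑v
    where u∈ = proj₁ (All.lookup G⊆Graver u∈G)
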